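{- Let $T$ be a tree and $f,g$ proper 3-colorings of $T$. Then $$\operatorname{dist}_{\mathcal{C}_3(T)}(f,g)=\min_{h\in D(f,g)}\|h\|_1 .$$
   Context: Let $T$ be a finite tree with vertex set $V$ and edge set $E$. A proper 3-coloring of $T$ is a map $f\colon V\to\mathbb{Z}/3\mathbb{Z}$ with $f(u)\neq f(v)$ for every edge $uv\in E$. The 3-coloring graph $\mathcal{C}_3(T)$ has the proper 3-colorings as vertices, two colorings adjacent iff they differ at exactly one vertex. A labeling of $T$ is a map $h\colon V\to\mathbb{Z}$ with $|h(u)-h(v)|\le 1$ for every edge $uv\in E$, and $\|h\|_1=\sum_{v\in V}|h(v)|$. Given proper 3-colorings $f,g$, $D(f,g)$ is the set of labelings $h$ with $h(v)\equiv g(v)-f(v)\pmod 3$ for all $v\in V$. -}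

module Defs where

open import Algebra.Properties.CommutativeMonoid.Sum as Sum using ()
open import Data.Fin.Base using (Fin; toℕ)
open import Data.Integer.Base as ℤ using (ℤ; +_; ∣_∣)
open import Data.Integer.Divisibility using () renaming (_∣_ to _∣ℤ_)
open import Data.List.Base using (List; []; _∷_)
open import Data.List.Relation.Unary.Unique.Propositional using (Unique)
open import Data.Nat.Base using (ℕ; suc; _≤_; NonZero)
open import Data.Nat.Properties using (+-0-commutativeMonoid)
open import Data.Product using (_×_; _,_; ∃; ∃!)
open import Data.Vec.Base using (Vec; lookup)
open import Relation.Binary.Construct.Closure.ReflexiveTransitive using (Star; ε; _◅_)
open import Relation.Binary.Definitions using (Decidable; Symmetric)
open import Relation.Binary.PropositionalEquality using (_≡_; _≢_; refl; sym)
open import Relation.Nullary.Negation.Core using (¬_)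

record Graph (V : Set) : Set₁ where
  field
    Adj        : V → V → Set
    adj-sym    : Symmetric Adj
    adj-irrefl : ∀ {v} → ¬ Adj v v

  Walk : V → V → Set
  Walk = Star Adj

  length : ∀ {u v} → Walk u v → ℕ
  length ε       = 0
  length (_ ◅ p) = suc (length p)

  vertices : ∀ {u v} → Walk u v → List V
  vertices {u} ε       = u ∷ []
  vertices {u} (_ ◅ p) = u ∷ vertices p

  Connected : Set
  Connected = ∀ u v → Walk u v

  -- A cycle is a path with at least three vertices together with an edge
  -- joining its two ends.
  record Cycle : Set where
    field
      {start end} : V
      path        : Walk start end
      simple      : Unique (vertices path)
      long        : 2 ≤ length path
      closing     : Adj end start

  Acyclic : Set
  Acyclic = ¬ Cycle

record Tree : Set₁ where
  field
    order     : ℕ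
    nonEmpty  : NonZero order
    graph     : Graph (Fin order)

  open Graph graph public

  field
    adj?      : Decidable Adj
    connected : Connected
    acyclic   : Acyclic

  Vertex : Set
  Vertex = Fin order

IsMinimum : {A : Set} → (A → ℕ) → ℕ → Set
IsMinimum φ m = (∃ λ a → φ a ≡ m) × (∀ a → m ≤ φ a)

-- u and v lie in one component of G and are at distance d.
IsDistance : {V : Set} → Graph V → V → V → ℕ → Set
IsDistance G u v = IsMinimum (Graph.length G {u} {v})

module _ (T : Tree) where
  open Tree T

  -- Elements of ℤ/3ℤ are represented by their residues in Fin 3.  The values
  -- are stored in a Vec so that colorings with the same values are
  -- propositionally equal.
  record Coloring : Set where
    constructor mkColoring
    field
      colors : Vec (Fin 3) order

    color : Vertex → Fin 3
    color = lookup colors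

    field
      proper : ∀ {u v} → Adj u v → color u ≢ color v

  open Coloring

  DifferAtExactlyOne : Coloring → Coloring → Set
  DifferAtExactlyOne f g = ∃! _≡_ λ v → color f v ≢ color g v

  𝒞₃ : Graph Coloring
  𝒞₃ = record
    { Adj        = DifferAtExactlyOne
    ; adj-sym    = λ (v , f≢g , uniq) →
                     v , (λ eq → f≢g (sym eq)) ,
                     λ g≢f → uniq λ eq → g≢f (sym eq)
    ; adj-irrefl = λ (_ , f≢f , _) → f≢f refl
    }

  record Labeling : Set where
    field
      label  : Vertex → ℤ
      smooth : ∀ {u v} → Adj u v → ∣ label u ℤ.- label v ∣ ≤ 1

  record D (f g : Coloring) : Set where
    field
      labeling  : Labeling

    open Labeling labeling public

    field
      congruent : ∀ v → + 3 ∣ℤ label v ℤ.- (+ toℕ (color g v) ℤ.- + toℕ (color f v))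

‖_‖₁ : {T : Tree} → Labeling T → ℕ
‖ h ‖₁ = Sum.sum +-0-commutativeMonoid λ v → ∣ Labeling.label h v ∣

{-# OPTIONS --safe #-}

-- Labelings behave like differences of height functions: if h ∈ D(e,f) and
-- k ∈ D(f,g) then h + k ∈ D(e,g), because an edge on which h + k jumps by 2
-- would force one of e, f, g to be improper there.  One recoloring step is a
-- labeling of norm 1, so a walk of length ℓ yields a labeling of norm ≤ ℓ.
--
-- Conversely, let h ∈ D(f,g) be positive somewhere.  A closed walk in a tree
-- crosses each edge equally often in both directions, so f lifts to an integer
-- height function H with |dH| = 1 on edges.  Among the vertices with h > 0 pick v with H(v) maximal.  Every
-- neighbour u has H(u) = H(v) - 1 (otherwise h(u) = 0, h(v) = 1, and
-- g(u) = g(v)), so v can be recolored to f(v) + 1, which lowers ‖h‖₁ by one.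
-- Where h is negative, exchange f and g.
--
-- Finally D(f,g) is nonempty, by lifting g - f, and consists of the translates
-- of any of its members by multiples of 3, so its minimum norm is found by a
-- bounded search.
module Submission where

open import Data.Bool.Base using (if_then_else_)
open import Data.Empty using (⊥)
open import Data.Fin.Base using (Fin; toℕ; fromℕ<; punchIn) renaming (zero to fzero; suc to fsuc)
open import Data.Fin.Properties as Fin using (punchInᵢ≢i; all?; any?)
open import Data.Integer.Base using (ℤ; +_; -[1+_]; -_; _+_; _-_; _*_; ∣_∣; 0ℤ; 1ℤ; -1ℤ; +<+; +≤+) renaming (_≤_ to _≤ᶻ_; _<_ to _<ᶻ_)
open import Data.Integer.DivMod using (_%ℕ_; _/ℕ_; n%ℕd<d; a≡a%ℕn+[a/ℕn]*n)
open import Data.Integer.Divisibility.Signed using (_∣_; divides; ∣ᵤ⇒∣; ∣⇒∣ᵤ; ∣m∣n⇒∣m+n; ∣m⇒∣-m)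
import Data.Integer.Properties as ℤ
open import Data.Integer.Tactic.RingSolver using (solve-∀)
open import Data.List.Base using (List; []; _∷_; _++_; map; filter; upTo; allFin)
open import Data.List.Membership.Propositional using (_∈_)
open import Data.List.Membership.Propositional.Properties using (∈-++⁺ˡ; ∈-++⁺ʳ; ∈-map⁺; ∈-upTo⁺; ∈-filter⁺; ∈-allFin)
open import Data.List.Relation.Unary.All as All using (All; []; _∷_)
open import Data.List.Relation.Unary.All.Properties using (all-filter)
open import Data.List.Relation.Unary.AllPairs using ([]; _∷_)
open import Data.List.Relation.Unary.Any using (here; there)
open import Data.List.Relation.Unary.Unique.Propositional using (Unique)
open import Data.Nat.Base as ℕ using (ℕ; suc; _≤_; z≤n; s≤s)
import Data.Nat.Divisibility as ℕ
open import Data.Nat.Induction using (Acc; acc; <-wellFounded)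
open import Data.Nat.Properties as ℕ using (+-0-commutativeMonoid)
open import Algebra.Properties.CommutativeMonoid.Sum +-0-commutativeMonoid using (sum; sum-remove; sum-cong-≗; sum-replicate-zero)
open import Data.Nat.Tactic.RingSolver using () renaming (solve-∀ to ℕ-solve-∀)
open import Data.Product using (∃; _×_; _,_; proj₁; proj₂)
open import Data.Sum.Base using (_⊎_; inj₁; inj₂)
open import Data.Vec.Base using (lookup; _[_]≔_)
open import Data.Vec.Properties using (lookup∘update; lookup∘update′; tabulate∘lookup; tabulate-cong)
open import Function.Base using (_∘_)
open import Relation.Binary.Construct.Closure.ReflexiveTransitive using (ε; _◅_; _◅◅_)
open import Relation.Binary.Definitions using (DecidableEquality)
open import Relation.Binary.PropositionalEquality using (_≡_; _≢_; refl; sym; trans; cong; cong₂; subst; module ≡-Reasoning)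
open import Relation.Nullary.Decidable using (yes; no; does; from-yes; from-no; _→-dec_; decidable-stable)
open import Relation.Nullary.Negation using (¬_; contradiction)

open import Defs

-- Congruences modulo 3

-- A record, so that x and y can be inferred from x ≡₃ y.
infix 4 _≡₃_
record _≡₃_ (x y : ℤ) : Set where
  constructor ⟨_⟩
  field 3∣- : + 3 ∣ x - y
open _≡₃_

≡₃-reflexive : ∀ {x y} → x ≡ y → x ≡₃ y
≡₃-reflexive {x} refl = ⟨ divides 0ℤ (ℤ.+-inverseʳ x) ⟩

≡₃-refl : ∀ x → x ≡₃ x
≡₃-refl _ = ≡₃-reflexive refl

≡₃-sym : ∀ {x y} → x ≡₃ y → y ≡₃ x
≡₃-sym {x} {y} ⟨ p ⟩ = ⟨ subst (+ 3 ∣_) (eq x y) (∣m⇒∣-m p) ⟩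
  where
  eq : ∀ x y → - (x - y) ≡ y - x
  eq = solve-∀

≡₃-trans : ∀ {x y z} → x ≡₃ y → y ≡₃ z → x ≡₃ z
≡₃-trans {x} {y} {z} ⟨ p ⟩ ⟨ q ⟩ = ⟨ subst (+ 3 ∣_) (eq x y z) (∣m∣n⇒∣m+n p q) ⟩
  where
  eq : ∀ x y z → (x - y) + (y - z) ≡ x - z
  eq = solve-∀

≡₃-+ : ∀ {x y z w} → x ≡₃ y → z ≡₃ w → x + z ≡₃ y + w
≡₃-+ {x} {y} {z} {w} ⟨ p ⟩ ⟨ q ⟩ = ⟨ subst (+ 3 ∣_) (eq x y z w) (∣m∣n⇒∣m+n p q) ⟩
  where
  eq : ∀ x y z w → (x - y) + (z - w) ≡ x + z - (y + w)
  eq = solve-∀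

≡₃-neg : ∀ {x y} → x ≡₃ y → - x ≡₃ - y
≡₃-neg {x} {y} ⟨ p ⟩ = ⟨ subst (+ 3 ∣_) (eq x y) (∣m⇒∣-m p) ⟩
  where
  eq : ∀ x y → - (x - y) ≡ - x - - y
  eq = solve-∀

≡₃-- : ∀ {x y z w} → x ≡₃ y → z ≡₃ w → x - z ≡₃ y - w
≡₃-- p q = ≡₃-+ p (≡₃-neg q)

x-y≡₃0⇒x≡₃y : ∀ {x y} → x - y ≡₃ 0ℤ → x ≡₃ y
x-y≡₃0⇒x≡₃y {x} {y} ⟨ p ⟩ = ⟨ subst (+ 3 ∣_) (ℤ.+-identityʳ (x - y)) p ⟩

data Small : ℤ → Set where
  -1ˢ : Small -1ℤ
  0ˢ  : Small 0ℤ
  1ˢ  : Small 1ℤ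

small : ∀ x → ∣ x ∣ ≤ 1 → Small x
small (+ 0)           _ = 0ˢ
small (+ 1)           _ = 1ˢ
small (+ suc (suc _)) (s≤s ())
small -[1+ 0 ]        _ = -1ˢ
small -[1+ suc _ ]    (s≤s ())

-- Dividing `x + 1ℤ` by 3 leaves 0, 1 or 2; taking the 1 off again gives a representative among -1,
-- 0 and 1.
balance : ∀ x → ∃ λ r → ∣ r ∣ ≤ 1 × r ≡₃ x
balance x = m - 1ℤ , bound (n%ℕd<d (x + 1ℤ) 3) , ⟨ divides (- q) (begin
    m - 1ℤ - x         ≡⟨ eq₁ m x ⟩
    m - (x + 1ℤ)       ≡⟨ cong (λ y → m - y) (a≡a%ℕn+[a/ℕn]*n (x + 1ℤ) 3) ⟩
    m - (m + q * + 3)  ≡⟨ eq₂ m q (+ 3) ⟩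
    - q * + 3          ∎) ⟩
  where
  open ≡-Reasoning
  m = + ((x + 1ℤ) %ℕ 3)
  q = (x + 1ℤ) /ℕ 3
  eq₁ : ∀ m x → m - 1ℤ - x ≡ m - (x + 1ℤ)
  eq₁ = solve-∀
  eq₂ : ∀ m q t → m - (m + q * t) ≡ - q * t
  eq₂ = solve-∀
  bound : ∀ {k} → k ℕ.< 3 → ∣ + k - 1ℤ ∣ ≤ 1
  bound {0} _ = s≤s z≤n
  bound {1} _ = z≤n
  bound {2} _ = s≤s z≤n
  bound {suc (suc (suc _))} (s≤s (s≤s (s≤s ())))

-- Such integers differ by at most 2, so 3 divides their difference only when it is 0. Hence the
-- representative given by `balance` is unique.
small-≡₃ : ∀ {x y} → ∣ x ∣ ≤ 1 → ∣ y ∣ ≤ 1 → x ≡₃ y → x ≡ y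
small-≡₃ {x} {y} ∣x∣≤1 ∣y∣≤1 ⟨ p ⟩ with small x ∣x∣≤1 | small y ∣y∣≤1
... | -1ˢ | -1ˢ = refl
... | -1ˢ | 0ˢ  = contradiction (∣⇒∣ᵤ p) (from-no (3 ℕ.∣? 1))
... | -1ˢ | 1ˢ  = contradiction (∣⇒∣ᵤ p) (from-no (3 ℕ.∣? 2))
... | 0ˢ  | -1ˢ = contradiction (∣⇒∣ᵤ p) (from-no (3 ℕ.∣? 1))
... | 0ˢ  | 0ˢ  = refl
... | 0ˢ  | 1ˢ  = contradiction (∣⇒∣ᵤ p) (from-no (3 ℕ.∣? 1))
... | 1ˢ  | -1ˢ = contradiction (∣⇒∣ᵤ p) (from-no (3 ℕ.∣? 2))
... | 1ˢ  | 0ˢ  = contradiction (∣⇒∣ᵤ p) (from-no (3 ℕ.∣? 1))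
... | 1ˢ  | 1ˢ  = refl

-- If d = e = 1 or d = e = -1, then x, x + d and x - e exhaust the residues.
sum-small : ∀ {x d e} → ∣ d ∣ ≤ 1 → ∣ e ∣ ≤ 1 →
            ¬ x ≡₃ 0ℤ → ¬ x + d ≡₃ 0ℤ → ¬ x - e ≡₃ 0ℤ → ∣ e + d ∣ ≤ 1
sum-small {x} {d} {e} ∣d∣≤1 ∣e∣≤1 x≢0 x+d≢0 x-e≢0 with small d ∣d∣≤1 | small e ∣e∣≤1 | balance x
... | -1ˢ | 0ˢ  | _ = s≤s z≤n
... | -1ˢ | 1ˢ  | _ = z≤n
... | 0ˢ  | -1ˢ | _ = s≤s z≤n
... | 0ˢ  | 0ˢ  | _ = z≤n
... | 0ˢ  | 1ˢ  | _ = s≤s z≤n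
... | 1ˢ  | -1ˢ | _ = z≤n
... | 1ˢ  | 0ˢ  | _ = s≤s z≤n
... | -1ˢ | -1ˢ | r , ∣r∣≤1 , r≡x with small r ∣r∣≤1
...   | -1ˢ = contradiction (≡₃-+ (≡₃-sym r≡x) (≡₃-refl _)) x-e≢0
...   | 0ˢ  = contradiction (≡₃-sym r≡x) x≢0
...   | 1ˢ  = contradiction (≡₃-+ (≡₃-sym r≡x) (≡₃-refl _)) x+d≢0
sum-small {x} {d} {e} ∣d∣≤1 ∣e∣≤1 x≢0 x+d≢0 x-e≢0 | 1ˢ | 1ˢ | r , ∣r∣≤1 , r≡x with small r ∣r∣≤1
...   | -1ˢ = contradiction (≡₃-+ (≡₃-sym r≡x) (≡₃-refl _)) x+d≢0
...   | 0ˢ  = contradiction (≡₃-sym r≡x) x≢0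
...   | 1ˢ  = contradiction (≡₃-+ (≡₃-sym r≡x) (≡₃-refl _)) x-e≢0

-- Edge weights on acyclic graphs

module Weights {V : Set} (_≟_ : DecidableEquality V) (G : Graph V) (acyclic : Graph.Acyclic G)
               (w : V → V → ℤ) (w-antisym : ∀ u v → w u v ≡ - w v u) where
  open Graph G
  open import Data.List.Membership.DecPropositional _≟_ using (_∈?_)

  weight : ∀ {u v} → Walk u v → ℤ
  weight ε                 = 0ℤ
  weight (_◅_ {u} {v} _ p) = w u v + weight p

  weight-◅◅ : ∀ {u v x} (p : Walk u v) (q : Walk v x) → weight (p ◅◅ q) ≡ weight p + weight q
  weight-◅◅ ε                 q = sym (ℤ.+-identityˡ (weight q))
  weight-◅◅ (_◅_ {u} {v} e p) q = trans (cong (_+_ (w u v)) (weight-◅◅ p q)) (sym (ℤ.+-assoc (w u v) (weight p) (weight q)))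

  -- Of the factorization of `p` only the weights are kept. The inclusion `before⊆p` is phrased
  -- through arbitrary predicates, so that a vertex avoided by `p` is at once avoided by `before`.
  record Split {u v} (p : Walk u v) (x : V) : Set₁ where
    field
      before        : Walk u x
      after         : Walk x v
      before-unique : Unique (vertices before)
      after-unique  : Unique (vertices after)
      before⊆p      : ∀ {P : V → Set} → All P (vertices p) → All P (vertices before)
      weights       : weight before + weight after ≡ weight p

  split : ∀ {u v x} (p : Walk u v) → Unique (vertices p) → x ∈ vertices p → Split p x
  split ε unique (here refl) = record
    { before = ε ; after = ε ; before-unique = unique ; after-unique = unique
    ; before⊆p = λ all → all ; weights = refl }
  split (e ◅ p) unique (here refl) = record
    { before = ε ; after = e ◅ p ; before-unique = [] ∷ [] ; after-unique = unique
    ; before⊆p = λ { (px ∷ _) → px ∷ [] } ; weights = ℤ.+-identityˡ _ }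
  split (_◅_ {u} {v} e p) (u∉p ∷ unique) (there x∈p) = record
    { before = e ◅ before ; after = after
    ; before-unique = before⊆p u∉p ∷ before-unique ; after-unique = after-unique
    ; before⊆p = λ { (pu ∷ all) → pu ∷ before⊆p all }
    ; weights = trans (ℤ.+-assoc (w u v) (weight before) (weight after)) (cong (_+_ (w u v)) weights) }
    where open Split (split p unique x∈p)

  -- With two or more edges the simple walk would close up to a cycle through `e`; only a single
  -- edge remains.
  weight-return : ∀ {u v} → Adj u v → (p : Walk v u) → Unique (vertices p) → weight p ≡ w v u
  weight-return e ε             _      = contradiction e adj-irrefl
  weight-return e (e′ ◅ ε)      _      = ℤ.+-identityʳ _
  weight-return e (a ◅ b ◅ p)   unique = contradiction
    (record { path = a ◅ b ◅ p ; simple = unique ; long = s≤s (s≤s z≤n) ; closing = e }) acyclic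

  simplify : ∀ {u v} (p : Walk u v) → ∃ λ (q : Walk u v) → Unique (vertices q) × weight q ≡ weight p
  simplify ε = ε , [] ∷ [] , refl
  simplify (_◅_ {u} {v} e p) with simplify p
  ... | q , unique , eq with u ∈? vertices q
  ...   | no u∉q = e ◅ q , All.tabulate (λ x∈q u≡x → u∉q (subst (_∈ vertices q) (sym u≡x) x∈q)) ∷ unique , cong (_+_ (w u v)) eq
  -- The loop from u through v back to u weighs `w u v + w v u`, which is 0 by antisymmetry, so it
  -- can be cut off.
  ...   | yes u∈q = after , after-unique , (begin
      weight after                           ≡⟨ cancel (w v u) (weight after) ⟩
      - w v u + (w v u + weight after)       ≡⟨ cong₂ (λ a b → a + (b + weight after)) (w-antisym u v) (weight-return e before before-unique) ⟨
      w u v + (weight before + weight after) ≡⟨ cong (_+_ (w u v)) (trans weights eq) ⟩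
      w u v + weight p                       ∎)
    where
    open Split (split q unique u∈q)
    open ≡-Reasoning
    cancel : ∀ x y → y ≡ - x + (x + y)
    cancel = solve-∀

  -- Simplification can only leave the empty walk, since a nonempty simple walk does not end where
  -- it starts.
  weight-closed : ∀ {v} (p : Walk v v) → weight p ≡ 0ℤ
  weight-closed p with simplify p
  ... | ε     , _        , eq = sym eq
  ... | e ◅ q , v∉q ∷ _ , _  = contradiction refl (All.lookup v∉q (end∈ q))
    where
    end∈ : ∀ {u v} (q : Walk u v) → v ∈ vertices q
    end∈ ε       = here refl
    end∈ (_ ◅ q) = there (end∈ q)

  -- `back` closes both `q` and the extension of `p` by the edge uv. Both closed walks weigh 0, and
  -- the weight of `back` cancels.
  weight-edge : ∀ {r u v} → Adj u v → (p : Walk r u) (q : Walk r v) → Walk v r → weight q - weight p ≡ w u v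
  weight-edge {r} {u} {v} e p q back = begin
    weight q - weight p                                               ≡⟨ eq (weight q) (weight p) (weight back) (w u v) ⟩
    (weight q + weight back) - (weight p + (w u v + weight back)) + w u v ≡⟨ cong₂ (λ a b → a - b + w u v) (closed q back) (closed p (e ◅ back)) ⟩
    0ℤ - 0ℤ + w u v                                                   ≡⟨ ℤ.+-identityˡ (w u v) ⟩
    w u v                                                             ∎
    where
    open ≡-Reasoning
    closed : ∀ {x} (p : Walk r x) (q : Walk x r) → weight p + weight q ≡ 0ℤ
    closed p q = trans (sym (weight-◅◅ p q)) (weight-closed (p ◅◅ q))
    eq : ∀ q p b w → q - p ≡ (q + b) - (p + (w + b)) + w
    eq = solve-∀

-- Sums and searches

-- The two sums share all terms off v. The additive form avoids truncated subtraction.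
sum-update : ∀ {n} (s t : Fin n → ℕ) v → (∀ {u} → u ≢ v → s u ≡ t u) → sum s ℕ.+ t v ≡ sum t ℕ.+ s v
sum-update {suc n} s t v s≡t = begin
  sum s ℕ.+ t v               ≡⟨ cong (ℕ._+ t v) (sum-remove {i = v} s) ⟩
  s v ℕ.+ rest s ℕ.+ t v      ≡⟨ cong (λ x → s v ℕ.+ x ℕ.+ t v) (sum-cong-≗ λ i → s≡t (punchInᵢ≢i v i)) ⟩
  s v ℕ.+ rest t ℕ.+ t v      ≡⟨ rotate (s v) (rest t) (t v) ⟩
  t v ℕ.+ rest t ℕ.+ s v      ≡⟨ cong (ℕ._+ s v) (sum-remove {i = v} t) ⟨
  sum t ℕ.+ s v               ∎
  where
  open ≡-Reasoning
  rest : (Fin (suc n) → ℕ) → ℕ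
  rest f = sum (f ∘ punchIn v)
  rotate : ∀ a b c → a ℕ.+ b ℕ.+ c ≡ c ℕ.+ b ℕ.+ a
  rotate = ℕ-solve-∀

entry≤sum : ∀ {n} (t : Fin n → ℕ) v → t v ≤ sum t
entry≤sum {suc n} t v = subst (t v ≤_) (sym (sum-remove {i = v} t)) (ℕ.m≤m+n (t v) _)

integersUpTo : ℕ → List ℤ
integersUpTo n = map +_ (upTo (suc n)) ++ map (λ i → - (+ i)) (upTo (suc n))

∈-integersUpTo : ∀ {n} q → ∣ q ∣ ≤ n → q ∈ integersUpTo n
∈-integersUpTo (+ i)    i≤n = ∈-++⁺ˡ (∈-map⁺ +_ (∈-upTo⁺ (s≤s i≤n)))
∈-integersUpTo {n} -[1+ i ] i<n = ∈-++⁺ʳ (map +_ (upTo (suc n))) (∈-map⁺ (λ i → - (+ i)) (∈-upTo⁺ (s≤s i<n)))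

minimum-within : (φ : ℤ → ℕ) (n : ℕ) → ∃ λ q₀ → ∀ q → ∣ q ∣ ≤ n → φ q₀ ≤ φ q
minimum-within φ n =
  argmin φ 0ℤ (integersUpTo n) ,
  λ q ∣q∣≤n → All.lookup (f[argmin]≤f[xs] {f = φ} 0ℤ (integersUpTo n)) (∈-integersUpTo q ∣q∣≤n)
  where open import Data.List.Extrema ℕ.≤-totalOrder

highest : ∀ {n} (H h : Fin n → ℤ) {v₀} → 0ℤ <ᶻ h v₀ →
          ∃ λ v → 0ℤ <ᶻ h v × (∀ u → 0ℤ <ᶻ h u → H u ≤ᶻ H v)
highest {n} H h {v₀} 0<hv₀ =
  -- The default value `v₀` is itself positive for `h`, so the maximizer is positive whichever way
  -- it arises.
  argmax H v₀ positive ,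
  argmax-all H {P = λ v → 0ℤ <ᶻ h v} 0<hv₀ (all-filter pos? (allFin n)) ,
  λ u 0<hu → All.lookup (f[xs]≤f[argmax] {f = H} v₀ positive) (∈-filter⁺ pos? (∈-allFin u) 0<hu)
  where
  open import Data.List.Extrema ℤ.≤-totalOrder
  pos? = λ v → 0ℤ ℤ.<? h v
  positive = filter pos? (allFin n)

-- Colors

residue : Fin 3 → ℤ
residue a = + toℕ a

residue-injective : ∀ a b → residue a ≡₃ residue b → a ≡ b
residue-injective a b ⟨ p ⟩ = dec a b (∣⇒∣ᵤ p)
  where
  dec = from-yes (all? λ a → all? λ b → (3 ℕ.∣? ∣ residue a - residue b ∣) →-dec (a Fin.≟ b))

next : Fin 3 → Fin 3
next fzero               = fsuc fzero
next (fsuc fzero)        = fsuc (fsuc fzero)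
next (fsuc (fsuc fzero)) = fzero

residue-next : ∀ a → residue (next a) ≡₃ residue a + 1ℤ
residue-next fzero               = ⟨ divides 0ℤ refl ⟩
residue-next (fsuc fzero)        = ⟨ divides 0ℤ refl ⟩
residue-next (fsuc (fsuc fzero)) = ⟨ divides -1ℤ refl ⟩

next≢ : ∀ a → a ≢ next a
next≢ fzero               ()
next≢ (fsuc fzero)        ()
next≢ (fsuc (fsuc fzero)) ()

module _ (T : Tree) where
  open Tree T
  open Coloring
  open D using (label; smooth; labeling)
  private module 𝒞 = Graph (𝒞₃ T)

  -- Integer lifts of residues on the tree

  root : Vertex
  root = fromℕ< (ℕ.>-nonZero⁻¹ order {{nonEmpty}})

  lift : (c : Vertex → ℤ) → ∃ λ p → (∀ {u v} → Adj u v → ∣ p u - p v ∣ ≤ 1) × (∀ v → p v ≡₃ c v)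
  lift c = p , p-smooth , p≡c
    where
    w : Vertex → Vertex → ℤ
    w u v = proj₁ (balance (c v - c u))

    ∣w∣≤1 : ∀ u v → ∣ w u v ∣ ≤ 1
    ∣w∣≤1 u v = proj₁ (proj₂ (balance (c v - c u)))

    w≡dc : ∀ u v → w u v ≡₃ c v - c u
    w≡dc u v = proj₂ (proj₂ (balance (c v - c u)))

    w-antisym : ∀ u v → w u v ≡ - w v u
    w-antisym u v = small-≡₃ (∣w∣≤1 u v) (subst (_≤ 1) (sym (ℤ.∣-i∣≡∣i∣ (w v u))) (∣w∣≤1 v u))
      (≡₃-trans (≡₃-trans (w≡dc u v) (≡₃-reflexive (eq (c u) (c v)))) (≡₃-neg (≡₃-sym (w≡dc v u))))
      where
      eq : ∀ x y → y - x ≡ - (x - y)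
      eq = solve-∀

    open Weights Fin._≟_ graph acyclic w w-antisym

    weight≡dc : ∀ {u v} (p : Walk u v) → weight p ≡₃ c v - c u
    weight≡dc {u} ε = ≡₃-reflexive (sym (ℤ.+-inverseʳ (c u)))
    weight≡dc {u} {v} (_◅_ {_} {x} _ p) =
      ≡₃-trans (≡₃-+ (w≡dc u x) (weight≡dc p)) (≡₃-reflexive (eq (c u) (c x) (c v)))
      where
      eq : ∀ a b d → (b - a) + (d - b) ≡ d - a
      eq = solve-∀

    p : Vertex → ℤ
    p v = c root + weight (connected root v)

    p-smooth : ∀ {u v} → Adj u v → ∣ p u - p v ∣ ≤ 1
    p-smooth {u} {v} e = subst (λ x → ∣ x ∣ ≤ 1)
      (sym (trans (eq (c root) _ _) (weight-edge (adj-sym e) (connected root v) (connected root u) (connected u root))))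
      (∣w∣≤1 v u)
      where
      eq : ∀ r a b → (r + a) - (r + b) ≡ a - b
      eq = solve-∀

    p≡c : ∀ v → p v ≡₃ c v
    p≡c v = ≡₃-trans (≡₃-+ (≡₃-refl (c root)) (weight≡dc (connected root v))) (≡₃-reflexive (eq (c root) (c v)))
      where
      eq : ∀ r x → r + (x - r) ≡ x
      eq = solve-∀

  value : Coloring T → Vertex → ℤ
  value f v = residue (color f v)

  value-proper : ∀ f {u v} → Adj u v → ¬ value f u - value f v ≡₃ 0ℤ
  value-proper f e p = proper f e (residue-injective _ _ (x-y≡₃0⇒x≡₃y p))

  -- The properness proofs agree definitionally, as ⊥ is proof-irrelevant.
  coloring-ext : ∀ {f g : Coloring T} → (∀ v → color f v ≡ color g v) → f ≡ g
  coloring-ext {mkColoring cs _} {mkColoring ds _} eq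
    with refl ← trans (sym (tabulate∘lookup cs)) (trans (tabulate-cong eq) (tabulate∘lookup ds)) = refl

  -- The groupoid structure of D

  mkD : ∀ {f g} (l : Vertex → ℤ) → (∀ {u v} → Adj u v → ∣ l u - l v ∣ ≤ 1) →
        (∀ v → l v ≡₃ value g v - value f v) → D T f g
  mkD l l-smooth l≡ = record
    { labeling  = record { label = l ; smooth = l-smooth }
    ; congruent = λ v → ∣⇒∣ᵤ (3∣- (l≡ v)) }

  label≡₃ : ∀ {f g} (h : D T f g) v → label h v ≡₃ value g v - value f v
  label≡₃ h v = ⟨ ∣ᵤ⇒∣ (D.congruent h v) ⟩

  -- Through this congruence, properness of `f` and `g` on uv restricts how `h` may jump there.
  label-edge : ∀ {f g} (h : D T f g) u v →
               (value f u - value f v) + (label h u - label h v) ≡₃ value g u - value g v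
  label-edge {f} {g} h u v = ≡₃-trans
    (≡₃-+ (≡₃-refl (value f u - value f v)) (≡₃-- (label≡₃ h u) (label≡₃ h v)))
    (≡₃-reflexive (eq (value f u) (value f v) (value g u) (value g v)))
    where
    eq : ∀ a b c d → (a - b) + ((c - a) - (d - b)) ≡ c - d
    eq = solve-∀

  D-refl : ∀ {f} → D T f f
  D-refl {f} = mkD (λ _ → 0ℤ) (λ _ → z≤n) (λ v → ≡₃-reflexive (sym (ℤ.+-inverseʳ (value f v))))

  D-sym : ∀ {f g} → D T f g → D T g f
  D-sym {f} {g} h = mkD (λ v → - label h v)
    (λ {u} {v} e → subst (_≤ 1)
      (trans (sym (ℤ.∣-i∣≡∣i∣ (label h u - label h v))) (cong ∣_∣ (ℤ.neg-distrib-+ (label h u) (- label h v)))) (smooth h e))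
    (λ v → ≡₃-trans (≡₃-neg (label≡₃ h v)) (≡₃-reflexive (eq (value g v) (value f v))))
    where
    eq : ∀ x y → - (x - y) ≡ y - x
    eq = solve-∀

  D-trans : ∀ {e f g} → D T e f → D T f g → D T e g
  D-trans {e} {f} {g} k h = mkD (λ v → label k v + label h v)
    (λ {u} {v} uv → subst (λ x → ∣ x ∣ ≤ 1) (eq₁ (label k u) (label k v) (label h u) (label h v))
      -- Take x to be the difference of `f` across uv. Adding the jump of `h` gives the difference
      -- of `g`, subtracting the jump of `k` that of the coloring `e`; properness makes all three
      -- nonzero modulo 3.
      (sum-small (smooth h uv) (smooth k uv) (value-proper f uv)
        (λ p → value-proper g uv (≡₃-trans (≡₃-sym (label-edge h u v)) p))
        (λ p → value-proper e uv (≡₃-trans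
          (≡₃-trans (≡₃-reflexive (eq₂ (value e u - value e v) (label k u - label k v)))
            (≡₃-- (label-edge k u v) (≡₃-refl (label k u - label k v)))) p))))
    (λ v → ≡₃-trans (≡₃-+ (label≡₃ k v) (label≡₃ h v)) (≡₃-reflexive (eq₃ (value e v) (value f v) (value g v))))
    where
    eq₁ : ∀ a b c d → (a - b) + (c - d) ≡ (a + c) - (b + d)
    eq₁ = solve-∀
    eq₂ : ∀ x y → x ≡ x + y - y
    eq₂ = solve-∀
    eq₃ : ∀ a b c → (b - a) + (c - b) ≡ c - a
    eq₃ = solve-∀

  norm : ∀ {f g} → D T f g → ℕ
  norm h = ‖ labeling h ‖₁

  norm-sym : ∀ {f g} (h : D T f g) → norm (D-sym h) ≡ norm h
  norm-sym h = sum-cong-≗ λ v → ℤ.∣-i∣≡∣i∣ (label h v)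

  -- Recoloring a single vertex

  single : Vertex → ℤ → Vertex → ℤ
  single v k u = if does (u Fin.≟ v) then k else 0ℤ

  single-at : ∀ v k → single v k v ≡ k
  single-at v k with v Fin.≟ v
  ... | yes _  = refl
  ... | no v≢v = contradiction refl v≢v

  single-off : ∀ v k {u} → u ≢ v → single v k u ≡ 0ℤ
  single-off v k {u} u≢v with u Fin.≟ v
  ... | yes u≡v = contradiction u≡v u≢v
  ... | no _    = refl

  -- The only values are `k` and 0, so smoothness holds for every pair of vertices, adjacent or not.
  D-single : ∀ {f g} v k → ∣ k ∣ ≤ 1 → (∀ {u} → u ≢ v → color f u ≡ color g u) →
             k ≡₃ value g v - value f v → D T f g
  D-single {f} {g} v k ∣k∣≤1 f≡g k≡ = mkD (single v k) (λ {a} {b} _ → single-smooth a b) single≡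
    where
    single-smooth : ∀ a b → ∣ single v k a - single v k b ∣ ≤ 1
    single-smooth a b with a Fin.≟ v | b Fin.≟ v
    ... | yes _ | yes _ = subst (λ x → ∣ x ∣ ≤ 1) (sym (ℤ.+-inverseʳ k)) z≤n
    ... | yes _ | no _  = subst (λ x → ∣ x ∣ ≤ 1) (sym (ℤ.+-identityʳ k)) ∣k∣≤1
    ... | no _  | yes _ = subst (_≤ 1) (trans (sym (ℤ.∣-i∣≡∣i∣ k)) (cong ∣_∣ (sym (ℤ.+-identityˡ (- k))))) ∣k∣≤1
    ... | no _  | no _  = z≤n
    single≡ : ∀ u → single v k u ≡₃ value g u - value f u
    single≡ u with u Fin.≟ v
    ... | yes refl = k≡
    ... | no u≢v   = ≡₃-reflexive (sym (ℤ.i≡j⇒i-j≡0 (cong residue (sym (f≡g u≢v)))))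

  sum-single : ∀ v k (h : Vertex → ℤ) →
               sum (λ u → ∣ single v k u + h u ∣) ℕ.+ ∣ h v ∣ ≡ sum (λ u → ∣ h u ∣) ℕ.+ ∣ k + h v ∣
  sum-single v k h = trans
    (sum-update (λ u → ∣ single v k u + h u ∣) (λ u → ∣ h u ∣) v
      (λ {u} u≢v → cong ∣_∣ (trans (cong (λ x → x + h u) (single-off v k u≢v)) (ℤ.+-identityˡ (h u)))))
    (cong (λ x → sum (λ u → ∣ h u ∣) ℕ.+ ∣ x + h v ∣) (single-at v k))

  walk⇒D : ∀ {f g} (p : 𝒞.Walk f g) → ∃ λ (h : D T f g) → norm h ≤ 𝒞.length p
  walk⇒D ε = D-refl , ℕ.≤-reflexive (sum-replicate-zero order)
  walk⇒D {f} (_◅_ {_} {f′} (v , _ , uniq) p) =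
    let h , ‖h‖≤  = walk⇒D p
        k , ∣k∣≤1 , k≡ = balance (value f′ v - value f v)
        agree : ∀ {u} → u ≢ v → color f u ≡ color f′ u
        agree u≢v = decidable-stable (_ Fin.≟ _) (λ f≢f′ → u≢v (sym (uniq f≢f′)))
        s = D-single v k ∣k∣≤1 agree k≡
    -- The term `∣ label h v ∣` is added to both sides so that `sum-single` applies.
    in D-trans s h , ℕ.+-cancelʳ-≤ ∣ label h v ∣ _ _ (begin
      norm (D-trans s h) ℕ.+ ∣ label h v ∣       ≡⟨ sum-single v k (label h) ⟩
      norm h ℕ.+ ∣ k + label h v ∣               ≤⟨ ℕ.+-mono-≤ ‖h‖≤ (ℤ.∣i+j∣≤∣i∣+∣j∣ k (label h v)) ⟩
      𝒞.length p ℕ.+ (∣ k ∣ ℕ.+ ∣ label h v ∣)        ≤⟨ ℕ.+-monoʳ-≤ (𝒞.length p) (ℕ.+-monoˡ-≤ ∣ label h v ∣ ∣k∣≤1) ⟩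
      𝒞.length p ℕ.+ (1 ℕ.+ ∣ label h v ∣)            ≡⟨ ℕ.+-suc (𝒞.length p) ∣ label h v ∣ ⟩
      suc (𝒞.length p) ℕ.+ ∣ label h v ∣              ∎)
    where
    open ℕ.≤-Reasoning

  -- Descent along a labeling

  module Descent
      {f g : Coloring T} (h : D T f g)
      (H : Vertex → ℤ) (H-smooth : ∀ {u v} → Adj u v → ∣ H u - H v ∣ ≤ 1) (H≡f : ∀ v → H v ≡₃ value f v)
      {v : Vertex} (0<hv : 0ℤ <ᶻ label h v) (v-highest : ∀ u → 0ℤ <ᶻ label h u → H u ≤ᶻ H v) where

    H-edge : ∀ a b → value f a - value f b ≡₃ H a - H b
    H-edge a b = ≡₃-- (≡₃-sym (H≡f a)) (≡₃-sym (H≡f b))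

    nonpositive-edge : ∀ {u} → Adj u v → ¬ 0ℤ <ᶻ label h u → label h u - label h v ≡ -1ℤ
    nonpositive-edge {u} e hu≤0 = helper (small _ (smooth h e)) refl
      where
      absurd : 0ℤ ≤ᶻ label h u - label h v → ⊥
      absurd 0≤dh = hu≤0 (ℤ.<-≤-trans 0<hv (ℤ.0≤i-j⇒j≤i 0≤dh))
      helper : ∀ {d} → Small d → label h u - label h v ≡ d → d ≡ -1ℤ
      helper -1ˢ _  = refl
      helper 0ˢ  eq = contradiction (subst (0ℤ ≤ᶻ_) (sym eq) (+≤+ z≤n)) absurd
      helper 1ˢ  eq = contradiction (subst (0ℤ ≤ᶻ_) (sym eq) (+≤+ z≤n)) absurd

    below-v : ∀ {u} → Adj u v → H u - H v ≡ -1ℤ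
    below-v {u} e = helper (small _ (H-smooth e)) refl
      where
      helper : ∀ {d} → Small d → H u - H v ≡ d → d ≡ -1ℤ
      helper -1ˢ _  = refl
      helper 0ˢ  eq = contradiction (≡₃-trans (H-edge u v) (≡₃-reflexive eq)) (value-proper f e)
      -- Here u is higher than v, so by the choice of v its label is not positive and `h` changes by
      -- -1 from v to u. This offsets the rise of `H`, and `g` would agree at u and v.
      helper 1ˢ  eq = contradiction
        (≡₃-trans (≡₃-sym (label-edge h u v)) (≡₃-+ (≡₃-trans (H-edge u v) (≡₃-reflexive eq)) (≡₃-reflexive dh)))
        (value-proper g e)
        where
        dh : label h u - label h v ≡ -1ℤ
        dh = nonpositive-edge e λ 0<hu →
          ℤ.<⇒≱ (+<+ (s≤s z≤n)) (subst (_≤ᶻ 0ℤ) eq (ℤ.i≤j⇒i-j≤0 (v-highest u 0<hu)))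

    colors′ = colors f [ v ]≔ next (color f v)

    at-v : lookup colors′ v ≡ next (color f v)
    at-v = lookup∘update v (colors f) _

    off-v : ∀ {u} → u ≢ v → lookup colors′ u ≡ color f u
    off-v u≢v = lookup∘update′ u≢v (colors f) _

    -- A neighbour colored f(v) + 1 would be at difference 1 from v, while the height function gives
    -- -1; these are distinct modulo 3.
    next-proper : ∀ {u} → Adj u v → color f u ≢ next (color f v)
    next-proper {u} e eq = contradiction (small-≡₃ {1ℤ} { -1ℤ} (s≤s z≤n) (s≤s z≤n) 1≡-1) λ ()
      where
      cancel : ∀ x → x + 1ℤ - x ≡ 1ℤ
      cancel = solve-∀
      1≡-1 : 1ℤ ≡₃ -1ℤ
      1≡-1 = ≡₃-trans (≡₃-reflexive (sym (cancel (value f v))))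
        (≡₃-trans (≡₃-- (≡₃-sym (residue-next (color f v))) (≡₃-refl (value f v)))
          (≡₃-trans (≡₃-reflexive (cong (λ x → residue x - value f v) (sym eq)))
            (≡₃-trans (H-edge u v) (≡₃-reflexive (below-v e)))))

    f′ : Coloring T
    f′ = mkColoring colors′ proper′
      where
      proper′ : ∀ {a b} → Adj a b → lookup colors′ a ≢ lookup colors′ b
      proper′ {a} {b} e eq with a Fin.≟ v | b Fin.≟ v
      ... | yes refl | yes refl = adj-irrefl e
      ... | yes refl | no b≢v   = next-proper (adj-sym e) (trans (sym (off-v b≢v)) (trans (sym eq) at-v))
      ... | no a≢v   | yes refl = next-proper e (trans (sym (off-v a≢v)) (trans eq at-v))
      ... | no a≢v   | no b≢v   = proper f e (trans (sym (off-v a≢v)) (trans eq (off-v b≢v)))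

    f~f′ : DifferAtExactlyOne T f f′
    f~f′ = v , (λ eq → next≢ (color f v) (trans eq at-v)) ,
      λ {u} f≢f′ → decidable-stable (v Fin.≟ u) λ v≢u → f≢f′ (sym (off-v (v≢u ∘ sym)))

    step : D T f′ f
    -- The sign is negative because `step` leads from the raised color back to the color of `f`.
    step = D-single v -1ℤ (s≤s z≤n) off-v
      (≡₃-sym (≡₃-trans
        (≡₃-- (≡₃-refl (value f v)) (≡₃-trans (≡₃-reflexive (cong residue at-v)) (residue-next (color f v))))
        (≡₃-reflexive (cancel (value f v)))))
      where
      cancel : ∀ x → x - (x + 1ℤ) ≡ -1ℤ
      cancel = solve-∀

    h′ : D T f′ g
    h′ = D-trans step h

    norm-h′ : suc (norm h′) ≡ norm h
    norm-h′ = ℕ.+-cancelʳ-≡ ∣ -1ℤ + label h v ∣ _ _ (begin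
      suc (norm h′) ℕ.+ ∣ -1ℤ + label h v ∣  ≡⟨ ℕ.+-suc (norm h′) _ ⟨
      norm h′ ℕ.+ suc ∣ -1ℤ + label h v ∣    ≡⟨ cong (norm h′ ℕ.+_) (pred-abs 0<hv) ⟩
      norm h′ ℕ.+ ∣ label h v ∣              ≡⟨ sum-single v -1ℤ (label h) ⟩
      norm h ℕ.+ ∣ -1ℤ + label h v ∣         ∎)
      where
      open ≡-Reasoning
      pred-abs : ∀ {x} → 0ℤ <ᶻ x → suc ∣ -1ℤ + x ∣ ≡ ∣ x ∣
      pred-abs (+<+ {n = suc _} _) = refl

  descend : ∀ {f g} (h : D T f g) {v₀} → 0ℤ <ᶻ label h v₀ →
            ∃ λ f′ → DifferAtExactlyOne T f f′ × ∃ λ (h′ : D T f′ g) → suc (norm h′) ≡ norm h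
  descend {f} h 0<hv₀ =
    let H , H-smooth , H≡f = lift (value f)
        v , 0<hv , v-highest = highest H (label h) 0<hv₀
        open Descent h H H-smooth H≡f 0<hv v-highest
    in f′ , f~f′ , h′ , norm-h′

  -- Walks from labelings

  length-◅◅ : ∀ {e f g} (p : 𝒞.Walk e f) (q : 𝒞.Walk f g) →
              𝒞.length (p ◅◅ q) ≡ 𝒞.length p ℕ.+ 𝒞.length q
  length-◅◅ ε       q = refl
  length-◅◅ (_ ◅ p) q = cong suc (length-◅◅ p q)

  label≡0⇒color≡ : ∀ {f g} (h : D T f g) {v} → label h v ≡ 0ℤ → color f v ≡ color g v
  label≡0⇒color≡ h {v} hv≡0 = residue-injective _ _ (≡₃-sym (x-y≡₃0⇒x≡₃y
    (≡₃-trans (≡₃-sym (label≡₃ h v)) (≡₃-reflexive hv≡0))))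

  ≡⇒walk : ∀ {f g : Coloring T} → f ≡ g → ∃ λ (p : 𝒞.Walk f g) → 𝒞.length p ≡ 0
  ≡⇒walk refl = ε , refl

  zero⇒walk : ∀ {f g} (h : D T f g) → (∀ v → label h v ≡ 0ℤ) →
              ∃ λ (p : 𝒞.Walk f g) → 𝒞.length p ≡ norm h
  zero⇒walk h h≡0 =
    let p , ∣p∣≡0 = ≡⇒walk (coloring-ext λ v → label≡0⇒color≡ h (h≡0 v))
    in p , trans ∣p∣≡0 (sym (trans (sum-cong-≗ λ v → cong ∣_∣ (h≡0 v)) (sum-replicate-zero order)))

  D⇒walk : ∀ {f g} (h : D T f g) → Acc ℕ._<_ (norm h) →
           ∃ λ (p : 𝒞.Walk f g) → 𝒞.length p ≡ norm h
  D⇒walk {f} {g} h (acc rec) with any? (λ v → 0ℤ ℤ.<? label h v) | any? (λ v → label h v ℤ.<? 0ℤ)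
  ... | yes (_ , 0<hv) | _ =
    let f′ , e , h′ , ‖h′‖ = descend h 0<hv
        p , ∣p∣ = D⇒walk h′ (rec (ℕ.≤-reflexive ‖h′‖))
    in e ◅ p , trans (cong suc ∣p∣) ‖h′‖
  ... | no _ | yes (_ , hv<0) =
    -- Negation makes the negative label positive. The descent now recolors `g`, so its step is
    -- reversed and appended at the end of the walk.
    let g′ , e , h′ , ‖h′‖ = descend (D-sym h) (ℤ.neg-mono-< hv<0)
        ‖k‖ : suc (norm (D-sym h′)) ≡ norm h
        ‖k‖ = trans (cong suc (norm-sym h′)) (trans ‖h′‖ (norm-sym h))
        p , ∣p∣ = D⇒walk (D-sym h′) (rec (ℕ.≤-reflexive ‖k‖))
    in p ◅◅ (𝒞.adj-sym {g} {g′} e ◅ ε) ,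
       trans (length-◅◅ p _) (trans (ℕ.+-comm _ 1) (trans (cong suc ∣p∣) ‖k‖))
  ... | no h≯0 | no h≮0 = zero⇒walk h λ v →
    ℤ.≤-antisym (ℤ.≮⇒≥ λ 0<hv → h≯0 (v , 0<hv)) (ℤ.≮⇒≥ λ hv<0 → h≮0 (v , hv<0))

  -- Existence of a minimum

  D-inhabited : ∀ f g → D T f g
  D-inhabited f g =
    let h , h-smooth , h≡ = lift (λ v → value g v - value f v) in mkD h h-smooth h≡

  translate : ∀ {f g} → D T f g → ℤ → D T f g
  translate h q = mkD (λ v → label h v + q * + 3)
    (λ {u} {v} e → subst (λ x → ∣ x ∣ ≤ 1) (eq₁ (label h u) (label h v) (q * + 3)) (smooth h e))
    (λ v → ≡₃-trans ⟨ divides q (eq₂ (label h v) (q * + 3)) ⟩ (label≡₃ h v))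
    where
    eq₁ : ∀ a b c → a - b ≡ (a + c) - (b + c)
    eq₁ = solve-∀
    eq₂ : ∀ a c → a + c - a ≡ c
    eq₂ = solve-∀

  -- Along an edge h and k jump by the representative in {-1, 0, 1} of the same residue.
  difference-constant : ∀ {f g} (h k : D T f g) {u v} → Walk u v → label k u - label h u ≡ label k v - label h v
  difference-constant h k ε = refl
  difference-constant h k {u} (_◅_ {_} {x} e p) = trans edge (difference-constant h k p)
    where
    open ≡-Reasoning
    eq : ∀ a b c d → a - c ≡ (a - b) - (c - d) + (b - d)
    eq = solve-∀
    jump : label k u - label k x ≡ label h u - label h x
    jump = small-≡₃ (smooth k e) (smooth h e)
      (≡₃-trans (≡₃-- (label≡₃ k u) (label≡₃ k x)) (≡₃-sym (≡₃-- (label≡₃ h u) (label≡₃ h x))))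
    edge : label k u - label h u ≡ label k x - label h x
    edge = begin
      label k u - label h u
        ≡⟨ eq (label k u) (label k x) (label h u) (label h x) ⟩
      (label k u - label k x) - (label h u - label h x) + (label k x - label h x)
        ≡⟨ cong (λ y → y + (label k x - label h x)) (ℤ.i≡j⇒i-j≡0 jump) ⟩
      0ℤ + (label k x - label h x)
        ≡⟨ ℤ.+-identityˡ _ ⟩
      label k x - label h x ∎

  -- The quotient `q` is read off at the root, and constancy of the difference carries it to every
  -- vertex. The crude bound on `q` makes the search for a minimum finite.
  translates-exhaust : ∀ {f g} (h k : D T f g) →
    ∃ λ q → norm (translate h q) ≡ norm k × ∣ q ∣ ≤ norm k ℕ.+ norm h
  translates-exhaust h k
    with ⟨ divides q eq ⟩ ← ≡₃-trans (label≡₃ k root) (≡₃-sym (label≡₃ h root)) =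
    q , sum-cong-≗ (λ v → cong ∣_∣ (label-k v)) , (begin
      ∣ q ∣                            ≤⟨ ℕ.m≤m*n ∣ q ∣ 3 ⟩
      ∣ q ∣ ℕ.* 3                      ≡⟨ ℤ.abs-* q (+ 3) ⟨
      ∣ q * + 3 ∣                      ≡⟨ cong ∣_∣ eq ⟨
      ∣ label k root - label h root ∣  ≤⟨ ℤ.∣i-j∣≤∣i∣+∣j∣ (label k root) (label h root) ⟩
      ∣ label k root ∣ ℕ.+ ∣ label h root ∣ ≤⟨ ℕ.+-mono-≤ (entry≤sum (λ v → ∣ label k v ∣) root) (entry≤sum (λ v → ∣ label h v ∣) root) ⟩
      norm k ℕ.+ norm h                ∎)
    where
    open ℕ.≤-Reasoning
    cancel : ∀ a b → a + (b - a) ≡ b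
    cancel = solve-∀
    label-k : ∀ v → label h v + q * + 3 ≡ label k v
    label-k v = trans (cong (_+_ (label h v)) (trans (sym eq) (difference-constant h k (connected root v))))
      (cancel (label h v) (label k v))

  norm-minimum : ∀ {f g} → D T f g → ∃ (IsMinimum (norm {f} {g}))
  norm-minimum h = norm (translate h q₀) , (translate h q₀ , refl) , λ k → minimal k (ℕ.≤-total (norm h) (norm k))
    where
    size : ℤ → ℕ
    size q = norm (translate h q)
    -- A labeling of norm at most that of `h` is the translate by some `q` within twice the norm of
    -- `h`; any other is beaten by `q = 0ℤ`.
    smallest = minimum-within size (norm h ℕ.+ norm h)
    q₀ = proj₁ smallest
    size0 : size 0ℤ ≡ norm h
    size0 = sum-cong-≗ λ v → cong ∣_∣ (ℤ.+-identityʳ (label h v))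
    minimal : ∀ k → norm h ≤ norm k ⊎ norm k ≤ norm h → size q₀ ≤ norm k
    minimal k (inj₁ ‖h‖≤‖k‖) = ℕ.≤-trans (proj₂ smallest 0ℤ z≤n) (ℕ.≤-trans (ℕ.≤-reflexive size0) ‖h‖≤‖k‖)
    minimal k (inj₂ ‖k‖≤‖h‖) =
      let q , size≡ , ∣q∣≤ = translates-exhaust h k
      in ℕ.≤-trans (proj₂ smallest q (ℕ.≤-trans ∣q∣≤ (ℕ.+-monoˡ-≤ (norm h) ‖k‖≤‖h‖))) (ℕ.≤-reflexive size≡)

mainTheorem6 : (T : Tree) (f g : Coloring T) →
    ∃ λ d → IsDistance (𝒞₃ T) f g d
    × IsMinimum (λ (h : D T f g) → ‖ D.labeling h ‖₁) d
mainTheorem6 T f g =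
  -- A minimizing `h` yields a walk of length `d`, and any walk `q` yields a labeling of norm at
  -- most its length, so `q` is no shorter than `d`.
  let d , (h , ‖h‖≡d) , minimal = norm-minimum T (D-inhabited T f g)
      p , ∣p∣ = D⇒walk T h (<-wellFounded _)
  in d , ((p , trans ∣p∣ ‖h‖≡d) ,
          λ q → let k , ‖k‖≤∣q∣ = walk⇒D T q in ℕ.≤-trans (minimal k) ‖k‖≤∣q∣) ,
     (h , ‖h‖≡d) , minimal
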